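{- Let $t$ be a proof term and $A$ a formula of the natural deduction system $\mathsf{CD}$, and suppose $t:A$ in $\mathsf{CD}$. Then $t$ is strongly normalizable with respect to the relation $\mapsto$, that is, there is no infinite sequence $t=t_1\mapsto t_2\mapsto t_3\mapsto\cdots$.
   Context: **Language $\mathcal{L}$ of $\mathsf{CD}$.** First-order terms are variables $\alpha,\beta,\dots$, constants $\mathsf{c}$, and expressions $\mathsf{f}(m_1,\dots,m_n)$ with $\mathsf{f}$ an $n$-ary function constant and $m_1,\dots,m_n$ terms. There is a countable set of predicate symbols, including a $0$-ary symbol $\bot$ (falsity). Atomic formulas are $\mathcal{P}(m_1,\dots,m_n)$ with $\mathcal{P}$ an $n$-ary predicate symbol. Formulas are built from atomic formulas with $\lor,\land,\rightarrow,\forall,\exists$; $\lnot A$ abbreviates $A\rightarrow\bot$. A constant $\mathsf{0}$ of $\mathcal{L}$ is fixed. **Typing rules of $\mathsf{CD}$** (natural deduction with proof terms; proof-term variables $x^A$ carry their type $A$; square-bracketed assumptions are discharged; terms are considered up to renaming of bound variables and substitution is capture-avoiding). - Axiom: $x^A : A$. - Conjunction: from $u:A$ and $t:B$ infer $\langle u,t\rangle : A\wedge B$; from $u:A\wedge B$ infer $u\,\pi_0 : A$ and $u\,\pi_1 : B$. - Implication: from $t:A\rightarrow B$ and $u:A$ infer $t\,u:B$; from $u:B$ infer $\lambda x^A u : A\rightarrow B$ (binding $x^A$, discharging $[x^A:A]$). - Disjunction: from $u:A$ infer $\iota_0(u):A\lor B$; from $u:B$ infer $\iota_1(u):A\lor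 B$; from $u:A\lor B$, $w_1:C$ and $w_2:C$ infer $u\,[x^A.w_1,\,y^B.w_2] : C$ (binding $x^A$ in $w_1$ and $y^B$ in $w_2$). - Universal quantifier: from $u:\forall\alpha\,A$ infer $u\,m : A[m/\alpha]$ for any term $m$ of $\mathcal{L}$; from $u:A$ infer $\lambda\alpha\,u:\forall\alpha\,A$, provided $\alpha$ does not occur free in the type $B$ of any free variable $x^B$ of $u$. - Existential quantifier: from $u:A[m/\alpha]$ infer $(m,u):\exists\alpha\,A$; from $u:\exists\alpha\,A$ and $t:C$ infer $u\,[(\alpha,x^A).t]:C$ (binding $\alpha$ and $x^A$ in $t$), provided $\alpha$ is not free in $C$ nor in the type $B$ of any free variable of $t$ other than $x^A$. - Constant domain axiom: for each formula $I=\forall\alpha(A\lor B)\rightarrow \forall\alpha A\lor B$ with $\alpha$ not occurring in $B$, a constant $\mathcal{D}^I : I$ (also written $\mathcal{D}$). - Ex falso: from $u:\bot$ infer $\mathsf{efq}_P\,u : P$, with $P$ atomic. The notation $t:A$ means that $t$ is a proof term (possibly with free variables) assigned the type $A$ by these rules. **Reduction rules.** $(\lambda x.u)t\mapsto u[t/x]$; $(\lambda\alpha.u)m\mapsto u[m/\alpha]$; $\langle u_0,u_1\rangle\pi_i\mapsto u_i$ for $i=0,1$; $\iota_i(u)[x_0.t_0,x_1.t_1]\mapsto t_i[u/x_i]$ for $i=0,1$; $(m,u)[(\alpha,x).v]\mapsto v[m/\alpha][u/x]$ for each term $m$ of $\mathcal{L}$; $\mathcal{D}(\lambda\alpha\,\iota_0(u))\mapsto\iota_0(\lambda\alpha\,u)$;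 $\mathcal{D}(\lambda\alpha\,\iota_1(u))\mapsto\iota_1(u[\mathsf{0}/\alpha])$. For arbitrary proof terms, $t\mapsto u$ holds whenever $u$ is obtained from $t$ by applying one reduction rule to a subterm of $t$. -}

module Defs where

open import Data.Fin.Base using (Fin; zero; suc)
open import Data.Nat.Base using (ℕ; zero; suc)
open import Data.Product.Base using (∃; ∃-syntax)
open import Data.Vec.Base using (Vec; []; _∷_; lookup; map)
open import Function.Base using (flip)
open import Function.Bundles using (_↣_)
open import Induction.InfiniteDescent using (InfiniteDescendingSequenceFrom)
open import Relation.Nullary.Negation.Core using (¬_)

record Language : Set₁ where
  field
    Constant       : Set
    Function       : ℕ → Set      -- indexed by arity
    Predicate      : ℕ → Set      -- indexed by arity
    falsum         : Predicate 0
    𝟎              : Constant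
    pred-countable : ∃ Predicate ↣ ℕ

module CD (𝓛 : Language) where
  open Language 𝓛

  private
    variable
      k l m n : ℕ

  -- Syntax up to renaming of bound variables is represented by well-scoped
  -- de Bruijn indices: n bounds the free first-order variables, k the free
  -- proof-term variables.  Index zero is the innermost binder.

  data Term (n : ℕ) : Set where
    var : Fin n → Term n
    con : Constant → Term n
    fun : Function l → Vec (Term n) l → Term n

  data Atom (n : ℕ) : Set where
    rel : Predicate l → Vec (Term n) l → Atom n

  infixr 6 _∧_
  infixr 5 _∨_
  infixr 4 _⇒_

  data Formula (n : ℕ) : Set where
    atom        : Atom n → Formula n
    _∧_ _∨_ _⇒_ : Formula n → Formula n → Formula n
    all ex      : Formula (suc n) → Formula n

  ⊥ᶠ : Formula n
  ⊥ᶠ = atom (rel falsum [])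

  ¬ᶠ_ : Formula n → Formula n
  ¬ᶠ A = A ⇒ ⊥ᶠ

  Subst : ℕ → ℕ → Set
  Subst m n = Fin m → Term n

  mutual
    substTerm : Subst m n → Term m → Term n
    substTerm σ (var i)    = σ i
    substTerm σ (con c)    = con c
    substTerm σ (fun f ms) = fun f (substTerms σ ms)

    substTerms : Subst m n → Vec (Term m) l → Vec (Term n) l
    substTerms σ []       = []
    substTerms σ (a ∷ as) = substTerm σ a ∷ substTerms σ as

  shift : Subst n (suc n)
  shift i = var (suc i)

  lift : Subst m n → Subst (suc m) (suc n)
  lift σ zero    = var zero
  lift σ (suc i) = substTerm shift (σ i)

  single : Term n → Subst (suc n) n
  single a zero    = a
  single a (suc i) = var i

  substAtom : Subst m n → Atom m → Atom n
  substAtom σ (rel P ms) = rel P (substTerms σ ms)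

  substFormula : Subst m n → Formula m → Formula n
  substFormula σ (atom P) = atom (substAtom σ P)
  substFormula σ (A ∧ B)  = substFormula σ A ∧ substFormula σ B
  substFormula σ (A ∨ B)  = substFormula σ A ∨ substFormula σ B
  substFormula σ (A ⇒ B)  = substFormula σ A ⇒ substFormula σ B
  substFormula σ (all A)  = all (substFormula (lift σ) A)
  substFormula σ (ex A)   = ex (substFormula (lift σ) A)

  infix 9 _[_]ᶠ

  _[_]ᶠ : Formula (suc n) → Term n → Formula n
  A [ a ]ᶠ = substFormula (single a) A

  -- A formula of the form wkᶠ A is one in which the innermost variable
  -- does not occur; this expresses all the eigenvariable conditions.
  wkᶠ : Formula n → Formula (suc n)
  wkᶠ = substFormula shift

  infixl 8 _·_ _∙_
  infixl 9 _π₀ _π₁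

  -- Bound proof-term variables carry their type as an annotation;
  -- the types of the free ones are given by a context.
  data Proof (n k : ℕ) : Set where
    var     : Fin k → Proof n k
    ⟨_,_⟩   : Proof n k → Proof n k → Proof n k
    _π₀ _π₁ : Proof n k → Proof n k
    _·_     : Proof n k → Proof n k → Proof n k
    ƛ       : Formula n → Proof n (suc k) → Proof n k
    ι₀ ι₁   : Proof n k → Proof n k
    -- case u A w₁ B w₂  is  u [x^A.w₁ , y^B.w₂]
    case    : Proof n k →
              Formula n → Proof n (suc k) →
              Formula n → Proof n (suc k) → Proof n k
    _∙_     : Proof n k → Term n → Proof n k
    Λ       : Proof (suc n) k → Proof n k
    pack    : Term n → Proof n k → Proof n k
    -- unpack u A t  is  u [(α , x^A).t]
    unpack  : Proof n k → Formula (suc n) → Proof (suc n) (suc k) → Proof n k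
    -- 𝓓 A B  is  𝓓^I  for  I = ∀α(A ∨ B) → ∀α A ∨ B
    𝓓       : Formula (suc n) → Formula n → Proof n k
    efq     : Atom n → Proof n k → Proof n k

  substᵗ : Subst m n → Proof m k → Proof n k
  substᵗ σ (var x)            = var x
  substᵗ σ ⟨ u , t ⟩          = ⟨ substᵗ σ u , substᵗ σ t ⟩
  substᵗ σ (u π₀)             = substᵗ σ u π₀
  substᵗ σ (u π₁)             = substᵗ σ u π₁
  substᵗ σ (t · u)            = substᵗ σ t · substᵗ σ u
  substᵗ σ (ƛ A u)            = ƛ (substFormula σ A) (substᵗ σ u)
  substᵗ σ (ι₀ u)             = ι₀ (substᵗ σ u)
  substᵗ σ (ι₁ u)             = ι₁ (substᵗ σ u)
  substᵗ σ (case u A w₁ B w₂) =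
    case (substᵗ σ u) (substFormula σ A) (substᵗ σ w₁)
                      (substFormula σ B) (substᵗ σ w₂)
  substᵗ σ (u ∙ a)            = substᵗ σ u ∙ substTerm σ a
  substᵗ σ (Λ u)              = Λ (substᵗ (lift σ) u)
  substᵗ σ (pack a u)         = pack (substTerm σ a) (substᵗ σ u)
  substᵗ σ (unpack u A t)     =
    unpack (substᵗ σ u) (substFormula (lift σ) A) (substᵗ (lift σ) t)
  substᵗ σ (𝓓 A B)            = 𝓓 (substFormula (lift σ) A) (substFormula σ B)
  substᵗ σ (efq P u)          = efq (substAtom σ P) (substᵗ σ u)

  liftRen : (Fin k → Fin l) → Fin (suc k) → Fin (suc l)
  liftRen ρ zero    = zero
  liftRen ρ (suc x) = suc (ρ x)

  rename : (Fin k → Fin l) → Proof n k → Proof n l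
  rename ρ (var x)            = var (ρ x)
  rename ρ ⟨ u , t ⟩          = ⟨ rename ρ u , rename ρ t ⟩
  rename ρ (u π₀)             = rename ρ u π₀
  rename ρ (u π₁)             = rename ρ u π₁
  rename ρ (t · u)            = rename ρ t · rename ρ u
  rename ρ (ƛ A u)            = ƛ A (rename (liftRen ρ) u)
  rename ρ (ι₀ u)             = ι₀ (rename ρ u)
  rename ρ (ι₁ u)             = ι₁ (rename ρ u)
  rename ρ (case u A w₁ B w₂) =
    case (rename ρ u) A (rename (liftRen ρ) w₁) B (rename (liftRen ρ) w₂)
  rename ρ (u ∙ a)            = rename ρ u ∙ a
  rename ρ (Λ u)              = Λ (rename ρ u)
  rename ρ (pack a u)         = pack a (rename ρ u)
  rename ρ (unpack u A t)     = unpack (rename ρ u) A (rename (liftRen ρ) t)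
  rename ρ (𝓓 A B)            = 𝓓 A B
  rename ρ (efq P u)          = efq P (rename ρ u)

  Substᵖ : ℕ → ℕ → ℕ → Set
  Substᵖ n k l = Fin k → Proof n l

  liftᵖ : Substᵖ n k l → Substᵖ n (suc k) (suc l)
  liftᵖ τ zero    = var zero
  liftᵖ τ (suc x) = rename suc (τ x)

  -- used when passing under a binder of a first-order variable
  shiftᵖ : Substᵖ n k l → Substᵖ (suc n) k l
  shiftᵖ τ x = substᵗ shift (τ x)

  substᵖ : Substᵖ n k l → Proof n k → Proof n l
  substᵖ τ (var x)            = τ x
  substᵖ τ ⟨ u , t ⟩          = ⟨ substᵖ τ u , substᵖ τ t ⟩
  substᵖ τ (u π₀)             = substᵖ τ u π₀
  substᵖ τ (u π₁)             = substᵖ τ u π₁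
  substᵖ τ (t · u)            = substᵖ τ t · substᵖ τ u
  substᵖ τ (ƛ A u)            = ƛ A (substᵖ (liftᵖ τ) u)
  substᵖ τ (ι₀ u)             = ι₀ (substᵖ τ u)
  substᵖ τ (ι₁ u)             = ι₁ (substᵖ τ u)
  substᵖ τ (case u A w₁ B w₂) =
    case (substᵖ τ u) A (substᵖ (liftᵖ τ) w₁) B (substᵖ (liftᵖ τ) w₂)
  substᵖ τ (u ∙ a)            = substᵖ τ u ∙ a
  substᵖ τ (Λ u)              = Λ (substᵖ (shiftᵖ τ) u)
  substᵖ τ (pack a u)         = pack a (substᵖ τ u)
  substᵖ τ (unpack u A t)     =
    unpack (substᵖ τ u) A (substᵖ (liftᵖ (shiftᵖ τ)) t)
  substᵖ τ (𝓓 A B)            = 𝓓 A B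
  substᵖ τ (efq P u)          = efq P (substᵖ τ u)

  singleᵖ : Proof n k → Substᵖ n (suc k) k
  singleᵖ u zero    = u
  singleᵖ u (suc x) = var x

  infixl 9 _[_]ᵗ _[_]ᵖ

  _[_]ᵗ : Proof (suc n) k → Term n → Proof n k
  u [ a ]ᵗ = substᵗ (single a) u

  _[_]ᵖ : Proof n (suc k) → Proof n k → Proof n k
  u [ t ]ᵖ = substᵖ (singleᵖ t) u

  Context : ℕ → ℕ → Set
  Context n k = Vec (Formula n) k

  private
    variable
      Γ           : Context n k
      A B C       : Formula n
      P           : Atom n
      a           : Term n
      t t′ u u′ v : Proof n k
      w₁ w₁′ w₂ w₂′ : Proof n k

  infix 3 _⊢_∶_

  data _⊢_∶_ {n k : ℕ} (Γ : Context n k) : Proof n k → Formula n → Set where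
    ax  : (x : Fin k) → Γ ⊢ var x ∶ lookup Γ x
    ∧I  : Γ ⊢ u ∶ A → Γ ⊢ t ∶ B → Γ ⊢ ⟨ u , t ⟩ ∶ A ∧ B
    ∧E₀ : Γ ⊢ u ∶ A ∧ B → Γ ⊢ u π₀ ∶ A
    ∧E₁ : Γ ⊢ u ∶ A ∧ B → Γ ⊢ u π₁ ∶ B
    ⇒E  : Γ ⊢ t ∶ A ⇒ B → Γ ⊢ u ∶ A → Γ ⊢ t · u ∶ B
    ⇒I  : A ∷ Γ ⊢ u ∶ B → Γ ⊢ ƛ A u ∶ A ⇒ B
    ∨I₀ : Γ ⊢ u ∶ A → Γ ⊢ ι₀ u ∶ A ∨ B
    ∨I₁ : Γ ⊢ u ∶ B → Γ ⊢ ι₁ u ∶ A ∨ B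
    ∨E  : Γ ⊢ u ∶ A ∨ B → A ∷ Γ ⊢ w₁ ∶ C → B ∷ Γ ⊢ w₂ ∶ C →
          Γ ⊢ case u A w₁ B w₂ ∶ C
    ∀E  : Γ ⊢ u ∶ all A → (a : Term n) → Γ ⊢ u ∙ a ∶ A [ a ]ᶠ
    ∀I  : map wkᶠ Γ ⊢ u ∶ A → Γ ⊢ Λ u ∶ all A
    ∃I  : Γ ⊢ u ∶ A [ a ]ᶠ → Γ ⊢ pack a u ∶ ex A
    ∃E  : Γ ⊢ u ∶ ex A → A ∷ map wkᶠ Γ ⊢ t ∶ wkᶠ C →
          Γ ⊢ unpack u A t ∶ C
    cd  : (A : Formula (suc n)) (B : Formula n) →
          Γ ⊢ 𝓓 A B ∶ all (A ∨ wkᶠ B) ⇒ all A ∨ B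
    ⊥E  : Γ ⊢ u ∶ ⊥ᶠ → Γ ⊢ efq P u ∶ atom P

  infix 3 _▷_ _↦_

  data _▷_ {n k : ℕ} : Proof n k → Proof n k → Set where
    β-⇒  : ƛ A u · t ▷ u [ t ]ᵖ
    β-∀  : Λ u ∙ a ▷ u [ a ]ᵗ
    β-∧₀ : ⟨ u , t ⟩ π₀ ▷ u
    β-∧₁ : ⟨ u , t ⟩ π₁ ▷ t
    β-∨₀ : case (ι₀ u) A w₁ B w₂ ▷ w₁ [ u ]ᵖ
    β-∨₁ : case (ι₁ u) A w₁ B w₂ ▷ w₂ [ u ]ᵖ
    β-∃  : unpack (pack a u) A v ▷ v [ a ]ᵗ [ u ]ᵖ
    β-𝓓₀ : 𝓓 A B · Λ (ι₀ u) ▷ ι₀ (Λ u)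
    β-𝓓₁ : 𝓓 A B · Λ (ι₁ u) ▷ ι₁ (u [ con 𝟎 ]ᵗ)

  data _↦_ {n k : ℕ} : Proof n k → Proof n k → Set where
    root  : t ▷ t′ → t ↦ t′
    ⟨⟩ˡ   : u ↦ u′ → ⟨ u , t ⟩ ↦ ⟨ u′ , t ⟩
    ⟨⟩ʳ   : t ↦ t′ → ⟨ u , t ⟩ ↦ ⟨ u , t′ ⟩
    π₀ᶜ   : u ↦ u′ → u π₀ ↦ u′ π₀
    π₁ᶜ   : u ↦ u′ → u π₁ ↦ u′ π₁
    ·ˡ    : t ↦ t′ → t · u ↦ t′ · u
    ·ʳ    : u ↦ u′ → t · u ↦ t · u′
    ƛᶜ    : u ↦ u′ → ƛ A u ↦ ƛ A u′
    ι₀ᶜ   : u ↦ u′ → ι₀ u ↦ ι₀ u′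
    ι₁ᶜ   : u ↦ u′ → ι₁ u ↦ ι₁ u′
    caseᶜ : u ↦ u′ → case u A w₁ B w₂ ↦ case u′ A w₁ B w₂
    caseˡ : w₁ ↦ w₁′ → case u A w₁ B w₂ ↦ case u A w₁′ B w₂
    caseʳ : w₂ ↦ w₂′ → case u A w₁ B w₂ ↦ case u A w₁ B w₂′
    ∙ᶜ    : u ↦ u′ → u ∙ a ↦ u′ ∙ a
    Λᶜ    : u ↦ u′ → Λ u ↦ Λ u′
    packᶜ : u ↦ u′ → pack a u ↦ pack a u′
    unpackˡ : u ↦ u′ → unpack u A t ↦ unpack u′ A t
    unpackʳ : t ↦ t′ → unpack u A t ↦ unpack u A t′
    efqᶜ  : u ↦ u′ → efq P u ↦ efq P u′

  StronglyNormalizable : Proof n k → Set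
  StronglyNormalizable t = ¬ (∃[ s ] InfiniteDescendingSequenceFrom (flip _↦_) s t)

{-# OPTIONS --safe #-}
module Submission where

-- The first-order layer of a proof term plays no role in the termination of
-- its reductions.  Deleting every first-order term and every type annotation,
-- but keeping markers for the rules of the quantifiers, sends a proof of
-- CD to a term of an untyped calculus (Tm), and sends each reduction step to
-- exactly one step (erase-step).  A universal quantifier becomes a unary
-- type constructor with abstraction gen and instantiation inst, contracted by
-- inst (gen u) ⟶ u; likewise for the existential one.  Formulas become simple
-- types (shape), which are invariant under first-order substitution.  It thus
-- suffices that the erasure of a typable proof is strongly normalizing.
--
-- This is shown by reducibility (Red).  Since there are no permutative
-- conversions, a term is reducible at a sum type when it is strongly
-- normalizing and every injection to which it reduces has a reducible
-- argument; existential types are treated likewise.  The usual properties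
-- hold: reducible terms are strongly normalizing (red-sn), reducibility is
-- closed under reduction (red-step), and a neutral term is reducible as soon
-- as all its one-step reducts are (red-neutral).
--
-- The constant-domain constant D is reducible (red-D) because the value of its
-- argument is visible to reducibility: if gen (inl u) is reducible at □ (A ⊕ B)
-- then inst (gen (inl u)), hence also its reduct inl u, is reducible at A ⊕ B,
-- so u is reducible at A and gen u at □ A.  The other rule is similar.
-- The fundamental theorem (fundamental) then follows by induction on typing
-- derivations of CD itself; no typing relation on Tm is needed.

open import Defs
open import Data.Empty using (⊥; ⊥-elim)
open import Data.Fin.Base using (Fin; zero; suc)
open import Data.Nat.Base using (ℕ; zero; suc)
open import Data.Product.Base using (_×_; _,_; proj₁; proj₂)
open import Data.Vec.Base using (Vec; []; _∷_; lookup; map)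
open import Data.Vec.Properties using (lookup-map)
open import Function.Base using (_∘_; flip)
open import Induction.WellFounded using (Acc; acc)
open import Relation.Binary.Construct.Closure.ReflexiveTransitive using (Star; ε; _◅_)
open import Relation.Binary.PropositionalEquality
  using (_≡_; refl; sym; trans; cong; cong₂; subst)

private
  variable
    j k l : ℕ

-- The erased calculus

-- Proof terms without first-order terms and annotations; k bounds the free
-- variables.  In unpack u t only a proof variable is bound in t, and gen
-- binds nothing.
data Tm (k : ℕ) : Set where
  var     : Fin k → Tm k
  pair    : Tm k → Tm k → Tm k
  fst snd : Tm k → Tm k
  app     : Tm k → Tm k → Tm k
  lam     : Tm (suc k) → Tm k
  inl inr : Tm k → Tm k
  case    : Tm k → Tm (suc k) → Tm (suc k) → Tm k
  inst    : Tm k → Tm k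
  gen     : Tm k → Tm k
  pack    : Tm k → Tm k
  unpack  : Tm k → Tm (suc k) → Tm k
  D       : Tm k
  efq     : Tm k → Tm k

private
  variable
    t t′ u u′ v : Tm k
    w w₁ w₁′ w₂ w₂′ : Tm (suc k)

extᵣ : (Fin k → Fin l) → Fin (suc k) → Fin (suc l)
extᵣ ρ zero    = zero
extᵣ ρ (suc x) = suc (ρ x)

ren : (Fin k → Fin l) → Tm k → Tm l
ren ρ (var x)        = var (ρ x)
ren ρ (pair u t)     = pair (ren ρ u) (ren ρ t)
ren ρ (fst u)        = fst (ren ρ u)
ren ρ (snd u)        = snd (ren ρ u)
ren ρ (app t u)      = app (ren ρ t) (ren ρ u)
ren ρ (lam w)        = lam (ren (extᵣ ρ) w)
ren ρ (inl u)        = inl (ren ρ u)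
ren ρ (inr u)        = inr (ren ρ u)
ren ρ (case u w₁ w₂) = case (ren ρ u) (ren (extᵣ ρ) w₁) (ren (extᵣ ρ) w₂)
ren ρ (inst u)       = inst (ren ρ u)
ren ρ (gen u)        = gen (ren ρ u)
ren ρ (pack u)       = pack (ren ρ u)
ren ρ (unpack u w)   = unpack (ren ρ u) (ren (extᵣ ρ) w)
ren ρ D              = D
ren ρ (efq u)        = efq (ren ρ u)

-- Passing of a substitution under the binder of a proof variable.
ext : (Fin k → Tm l) → Fin (suc k) → Tm (suc l)
ext σ zero    = var zero
ext σ (suc x) = ren suc (σ x)

sub : (Fin k → Tm l) → Tm k → Tm l
sub σ (var x)        = σ x
sub σ (pair u t)     = pair (sub σ u) (sub σ t)
sub σ (fst u)        = fst (sub σ u)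
sub σ (snd u)        = snd (sub σ u)
sub σ (app t u)      = app (sub σ t) (sub σ u)
sub σ (lam w)        = lam (sub (ext σ) w)
sub σ (inl u)        = inl (sub σ u)
sub σ (inr u)        = inr (sub σ u)
sub σ (case u w₁ w₂) = case (sub σ u) (sub (ext σ) w₁) (sub (ext σ) w₂)
sub σ (inst u)       = inst (sub σ u)
sub σ (gen u)        = gen (sub σ u)
sub σ (pack u)       = pack (sub σ u)
sub σ (unpack u w)   = unpack (sub σ u) (sub (ext σ) w)
sub σ D              = D
sub σ (efq u)        = efq (sub σ u)

infixr 5 _▹_

-- Extends a substitution by a term for the innermost variable.
_▹_ : Tm l → (Fin k → Tm l) → Fin (suc k) → Tm l
(v ▹ σ) zero    = v
(v ▹ σ) (suc x) = σ x

infixl 9 _[_]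

-- Substitution of a term for the innermost variable.
_[_] : Tm (suc k) → Tm k → Tm k
w [ v ] = sub (v ▹ var) w

infix 3 _⟶_ _⟶*_

-- In β-D-inr the instantiation by the constant 0 has been erased, so that only
-- gen disappears.
data _⟶_ {k : ℕ} : Tm k → Tm k → Set where
  β-lam   : app (lam w) u ⟶ w [ u ]
  β-gen   : inst (gen u) ⟶ u
  β-fst   : fst (pair u t) ⟶ u
  β-snd   : snd (pair u t) ⟶ t
  β-inl   : case (inl u) w₁ w₂ ⟶ w₁ [ u ]
  β-inr   : case (inr u) w₁ w₂ ⟶ w₂ [ u ]
  β-pack  : unpack (pack u) w ⟶ w [ u ]
  β-D-inl : app D (gen (inl u)) ⟶ inl (gen u)
  β-D-inr : app D (gen (inr u)) ⟶ inr u
  pairˡ   : u ⟶ u′ → pair u t ⟶ pair u′ t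
  pairʳ   : t ⟶ t′ → pair u t ⟶ pair u t′
  fstᶜ    : u ⟶ u′ → fst u ⟶ fst u′
  sndᶜ    : u ⟶ u′ → snd u ⟶ snd u′
  appˡ    : t ⟶ t′ → app t u ⟶ app t′ u
  appʳ    : u ⟶ u′ → app t u ⟶ app t u′
  lamᶜ    : w ⟶ w₁ → lam w ⟶ lam w₁
  inlᶜ    : u ⟶ u′ → inl u ⟶ inl u′
  inrᶜ    : u ⟶ u′ → inr u ⟶ inr u′
  caseᶜ   : u ⟶ u′ → case u w₁ w₂ ⟶ case u′ w₁ w₂
  caseˡ   : w₁ ⟶ w₁′ → case u w₁ w₂ ⟶ case u w₁′ w₂
  caseʳ   : w₂ ⟶ w₂′ → case u w₁ w₂ ⟶ case u w₁ w₂′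
  instᶜ   : u ⟶ u′ → inst u ⟶ inst u′
  genᶜ    : u ⟶ u′ → gen u ⟶ gen u′
  packᶜ   : u ⟶ u′ → pack u ⟶ pack u′
  unpackˡ : u ⟶ u′ → unpack u w ⟶ unpack u′ w
  unpackʳ : w ⟶ w₁ → unpack u w ⟶ unpack u w₁
  efqᶜ    : u ⟶ u′ → efq u ⟶ efq u′

_⟶*_ : Tm k → Tm k → Set
_⟶*_ = Star _⟶_

-- Substitution algebra
--
-- Equations between substitutions are hypotheses holding pointwise, so that
-- function extensionality is not needed.

cong₃ : {A B C R : Set} (f : A → B → C → R) {a a′ : A} {b b′ : B} {c c′ : C} →
        a ≡ a′ → b ≡ b′ → c ≡ c′ → f a b c ≡ f a′ b′ c′
cong₃ f refl refl refl = refl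

ren-ren : {ρ₁ : Fin j → Fin k} {ρ₂ : Fin k → Fin l} {ρ : Fin j → Fin l} →
          (∀ x → ρ₂ (ρ₁ x) ≡ ρ x) → ∀ t → ren ρ₂ (ren ρ₁ t) ≡ ren ρ t
ren-ren {j} {k} {l} {ρ₁} {ρ₂} {ρ} eq = go
  where
  eq⁺ : ∀ x → extᵣ ρ₂ (extᵣ ρ₁ x) ≡ extᵣ ρ x
  eq⁺ zero    = refl
  eq⁺ (suc x) = cong suc (eq x)

  go : ∀ t → ren ρ₂ (ren ρ₁ t) ≡ ren ρ t
  go (var x)        = cong var (eq x)
  go (pair u t)     = cong₂ pair (go u) (go t)
  go (fst u)        = cong fst (go u)
  go (snd u)        = cong snd (go u)
  go (app t u)      = cong₂ app (go t) (go u)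
  go (lam w)        = cong lam (ren-ren eq⁺ w)
  go (inl u)        = cong inl (go u)
  go (inr u)        = cong inr (go u)
  go (case u w₁ w₂) = cong₃ case (go u) (ren-ren eq⁺ w₁) (ren-ren eq⁺ w₂)
  go (inst u)       = cong inst (go u)
  go (gen u)        = cong gen (go u)
  go (pack u)       = cong pack (go u)
  go (unpack u w)   = cong₂ unpack (go u) (ren-ren eq⁺ w)
  go D              = refl
  go (efq u)        = cong efq (go u)

sub-ren : {ρ : Fin j → Fin k} {σ : Fin k → Tm l} {τ : Fin j → Tm l} →
          (∀ x → σ (ρ x) ≡ τ x) → ∀ t → sub σ (ren ρ t) ≡ sub τ t
sub-ren {j} {k} {l} {ρ} {σ} {τ} eq = go
  where
  eq⁺ : ∀ x → ext σ (extᵣ ρ x) ≡ ext τ x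
  eq⁺ zero    = refl
  eq⁺ (suc x) = cong (ren suc) (eq x)

  go : ∀ t → sub σ (ren ρ t) ≡ sub τ t
  go (var x)        = eq x
  go (pair u t)     = cong₂ pair (go u) (go t)
  go (fst u)        = cong fst (go u)
  go (snd u)        = cong snd (go u)
  go (app t u)      = cong₂ app (go t) (go u)
  go (lam w)        = cong lam (sub-ren eq⁺ w)
  go (inl u)        = cong inl (go u)
  go (inr u)        = cong inr (go u)
  go (case u w₁ w₂) = cong₃ case (go u) (sub-ren eq⁺ w₁) (sub-ren eq⁺ w₂)
  go (inst u)       = cong inst (go u)
  go (gen u)        = cong gen (go u)
  go (pack u)       = cong pack (go u)
  go (unpack u w)   = cong₂ unpack (go u) (sub-ren eq⁺ w)
  go D              = refl
  go (efq u)        = cong efq (go u)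

ren-sub : {σ : Fin j → Tm k} {ρ : Fin k → Fin l} {τ : Fin j → Tm l} →
          (∀ x → ren ρ (σ x) ≡ τ x) → ∀ t → ren ρ (sub σ t) ≡ sub τ t
ren-sub {j} {k} {l} {σ} {ρ} {τ} eq = go
  where
  eq⁺ : ∀ x → ren (extᵣ ρ) (ext σ x) ≡ ext τ x
  eq⁺ zero    = refl
  eq⁺ (suc x) =
    trans (trans (ren-ren (λ _ → refl) (σ x)) (sym (ren-ren (λ _ → refl) (σ x))))
          (cong (ren suc) (eq x))

  go : ∀ t → ren ρ (sub σ t) ≡ sub τ t
  go (var x)        = eq x
  go (pair u t)     = cong₂ pair (go u) (go t)
  go (fst u)        = cong fst (go u)
  go (snd u)        = cong snd (go u)
  go (app t u)      = cong₂ app (go t) (go u)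
  go (lam w)        = cong lam (ren-sub eq⁺ w)
  go (inl u)        = cong inl (go u)
  go (inr u)        = cong inr (go u)
  go (case u w₁ w₂) = cong₃ case (go u) (ren-sub eq⁺ w₁) (ren-sub eq⁺ w₂)
  go (inst u)       = cong inst (go u)
  go (gen u)        = cong gen (go u)
  go (pack u)       = cong pack (go u)
  go (unpack u w)   = cong₂ unpack (go u) (ren-sub eq⁺ w)
  go D              = refl
  go (efq u)        = cong efq (go u)

sub-sub : {σ : Fin j → Tm k} {τ : Fin k → Tm l} {υ : Fin j → Tm l} →
          (∀ x → sub τ (σ x) ≡ υ x) → ∀ t → sub τ (sub σ t) ≡ sub υ t
sub-sub {j} {k} {l} {σ} {τ} {υ} eq = go
  where
  eq⁺ : ∀ x → sub (ext τ) (ext σ x) ≡ ext υ x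
  eq⁺ zero    = refl
  eq⁺ (suc x) =
    trans (trans (sub-ren (λ _ → refl) (σ x)) (sym (ren-sub (λ _ → refl) (σ x))))
          (cong (ren suc) (eq x))

  go : ∀ t → sub τ (sub σ t) ≡ sub υ t
  go (var x)        = eq x
  go (pair u t)     = cong₂ pair (go u) (go t)
  go (fst u)        = cong fst (go u)
  go (snd u)        = cong snd (go u)
  go (app t u)      = cong₂ app (go t) (go u)
  go (lam w)        = cong lam (sub-sub eq⁺ w)
  go (inl u)        = cong inl (go u)
  go (inr u)        = cong inr (go u)
  go (case u w₁ w₂) = cong₃ case (go u) (sub-sub eq⁺ w₁) (sub-sub eq⁺ w₂)
  go (inst u)       = cong inst (go u)
  go (gen u)        = cong gen (go u)
  go (pack u)       = cong pack (go u)
  go (unpack u w)   = cong₂ unpack (go u) (sub-sub eq⁺ w)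
  go D              = refl
  go (efq u)        = cong efq (go u)

sub-id : {σ : Fin k → Tm k} → (∀ x → σ x ≡ var x) → ∀ t → sub σ t ≡ t
sub-id {k} {σ} eq = go
  where
  eq⁺ : ∀ x → ext σ x ≡ var x
  eq⁺ zero    = refl
  eq⁺ (suc x) = cong (ren suc) (eq x)

  go : ∀ t → sub σ t ≡ t
  go (var x)        = eq x
  go (pair u t)     = cong₂ pair (go u) (go t)
  go (fst u)        = cong fst (go u)
  go (snd u)        = cong snd (go u)
  go (app t u)      = cong₂ app (go t) (go u)
  go (lam w)        = cong lam (sub-id eq⁺ w)
  go (inl u)        = cong inl (go u)
  go (inr u)        = cong inr (go u)
  go (case u w₁ w₂) = cong₃ case (go u) (sub-id eq⁺ w₁) (sub-id eq⁺ w₂)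
  go (inst u)       = cong inst (go u)
  go (gen u)        = cong gen (go u)
  go (pack u)       = cong pack (go u)
  go (unpack u w)   = cong₂ unpack (go u) (sub-id eq⁺ w)
  go D              = refl
  go (efq u)        = cong efq (go u)

sub-ext-[] : (σ : Fin k → Tm l) (w : Tm (suc k)) (v : Tm l) →
             sub (ext σ) w [ v ] ≡ sub (v ▹ σ) w
sub-ext-[] σ w v = sub-sub pointwise w
  where
  pointwise : ∀ x → sub (v ▹ var) (ext σ x) ≡ (v ▹ σ) x
  pointwise zero    = refl
  pointwise (suc x) =
    trans (sub-ren (λ _ → refl) (σ x)) (sub-id (λ _ → refl) (σ x))

sub-[] : (σ : Fin k → Tm l) (w : Tm (suc k)) (u : Tm k) →
         sub (ext σ) w [ sub σ u ] ≡ sub σ (w [ u ])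
sub-[] σ w u = trans (sub-ext-[] σ w (sub σ u)) (sym (sub-sub pointwise w))
  where
  pointwise : ∀ x → sub σ ((u ▹ var) x) ≡ (sub σ u ▹ σ) x
  pointwise zero    = refl
  pointwise (suc x) = refl

⟶-resp-≡ : u ≡ u′ → t ⟶ u → t ⟶ u′
⟶-resp-≡ refl s = s

step-sub : (σ : Fin k → Tm l) → t ⟶ t′ → sub σ t ⟶ sub σ t′
step-sub σ (β-lam {w = w} {u = u}) = ⟶-resp-≡ (sub-[] σ w u) β-lam
step-sub σ β-gen         = β-gen
step-sub σ β-fst         = β-fst
step-sub σ β-snd         = β-snd
step-sub σ (β-inl {u = u} {w₁ = w₁}) = ⟶-resp-≡ (sub-[] σ w₁ u) β-inl
step-sub σ (β-inr {u = u} {w₂ = w₂}) = ⟶-resp-≡ (sub-[] σ w₂ u) β-inr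
step-sub σ (β-pack {u = u} {w = w}) = ⟶-resp-≡ (sub-[] σ w u) β-pack
step-sub σ β-D-inl       = β-D-inl
step-sub σ β-D-inr       = β-D-inr
step-sub σ (pairˡ s)     = pairˡ (step-sub σ s)
step-sub σ (pairʳ s)     = pairʳ (step-sub σ s)
step-sub σ (fstᶜ s)      = fstᶜ (step-sub σ s)
step-sub σ (sndᶜ s)      = sndᶜ (step-sub σ s)
step-sub σ (appˡ s)      = appˡ (step-sub σ s)
step-sub σ (appʳ s)      = appʳ (step-sub σ s)
step-sub σ (lamᶜ s)      = lamᶜ (step-sub (ext σ) s)
step-sub σ (inlᶜ s)      = inlᶜ (step-sub σ s)
step-sub σ (inrᶜ s)      = inrᶜ (step-sub σ s)
step-sub σ (caseᶜ s)     = caseᶜ (step-sub σ s)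
step-sub σ (caseˡ s)     = caseˡ (step-sub (ext σ) s)
step-sub σ (caseʳ s)     = caseʳ (step-sub (ext σ) s)
step-sub σ (instᶜ s)     = instᶜ (step-sub σ s)
step-sub σ (genᶜ s)      = genᶜ (step-sub σ s)
step-sub σ (packᶜ s)     = packᶜ (step-sub σ s)
step-sub σ (unpackˡ s)   = unpackˡ (step-sub σ s)
step-sub σ (unpackʳ s)   = unpackʳ (step-sub (ext σ) s)
step-sub σ (efqᶜ s)      = efqᶜ (step-sub σ s)

-- Strong normalization and neutral terms

SN : Tm k → Set
SN = Acc (flip _⟶_)

-- A function preserving steps reflects strong normalization.
sn-reflect : (f : Tm k → Tm l) → (∀ {t t′} → t ⟶ t′ → f t ⟶ f t′) →
             SN (f t) → SN t
sn-reflect f mono (acc rs) = acc λ s → sn-reflect f mono (rs (mono s))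

-- Variables and eliminations: filling the principal position of an elimination
-- with such a term creates no redex at the root.  The constant D is not neutral,
-- because app D t may be a redex, but app D t itself is.
data Neutral {k : ℕ} : Tm k → Set where
  var    : {x : Fin k} → Neutral (var x)
  fst    : Neutral (fst u)
  snd    : Neutral (snd u)
  app    : Neutral (app t u)
  case   : Neutral (case u w₁ w₂)
  inst   : Neutral (inst u)
  unpack : Neutral (unpack u w)
  efq    : Neutral (efq u)

-- A normal neutral term without free variables.  It is ill-typed, which is
-- harmless since reducibility is defined for untyped terms; it serves as an
-- inhabitant of every reducibility predicate.
stuck : Tm k
stuck = fst D

stuck-normal : stuck ⟶ t → ⊥
stuck-normal (fstᶜ ())

-- Reducibility

infixr 6 _⊗_
infixr 5 _⊕_
infixr 4 _⇒_

-- Simple types: □ and ◇ are what remains of the quantifiers.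
data Ty : Set where
  base        : Ty
  _⊗_ _⊕_ _⇒_ : Ty → Ty → Ty
  □ ◇         : Ty → Ty

-- Reducibility at a type, for open untyped terms.  At base it is strong
-- normalization; at ⊕ and ◇ it also speaks of
-- the introductions to which a term reduces; at ⊗, ⇒ and □ it speaks of
-- the eliminations applied to the term.
Red : Ty → Tm k → Set
Red base    t = SN t
Red (A ⊗ B) t = Red A (fst t) × Red B (snd t)
Red (A ⊕ B) t = SN t × (∀ u → t ⟶* inl u → Red A u) × (∀ u → t ⟶* inr u → Red B u)
Red (A ⇒ B) t = ∀ u → Red A u → Red B (app t u)
Red (□ A)   t = Red A (inst t)
Red (◇ A)   t = SN t × (∀ u → t ⟶* pack u → Red A u)

red-step : ∀ A → Red A t → t ⟶ t′ → Red A t′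
red-step base    (acc rs) s = rs s
red-step (A ⊗ B) (p , q)  s = red-step A p (fstᶜ s) , red-step B q (sndᶜ s)
red-step (A ⊕ B) (acc rs , p , q) s =
  rs s , (λ u ss → p u (s ◅ ss)) , (λ u ss → q u (s ◅ ss))
red-step (A ⇒ B) p        s = λ u r → red-step B (p u r) (appˡ s)
red-step (□ A)   p        s = red-step A p (instᶜ s)
red-step (◇ A)   (acc rs , p) s = rs s , λ u ss → p u (s ◅ ss)

red-sn : ∀ A → Red A t → SN t
-- Mutual with red-sn: at A ⇒ B each needs the other at A, red-sn in order to
-- have stuck as an argument, red-neutral for induction on the argument.
red-neutral : ∀ A → Neutral t → (∀ {t′} → t ⟶ t′ → Red A t′) → Red A t

red-stuck : ∀ A → Red A (stuck {k})
red-stuck A = red-neutral A fst λ s → ⊥-elim (stuck-normal s)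

red-sn base    p       = p
red-sn (A ⊗ B) (p , _) = sn-reflect fst fstᶜ (red-sn A p)
red-sn (A ⊕ B) (p , _) = p
red-sn (A ⇒ B) p       =
  sn-reflect (λ t → app t stuck) appˡ (red-sn B (p stuck (red-stuck A)))
red-sn (□ A)   p       = sn-reflect inst instᶜ (red-sn A p)
red-sn (◇ A)   (p , _) = p

red-neutral base    n h = acc h
red-neutral {t = t} (A ⊗ B) n h = red-neutral A fst (step₁ n) , red-neutral B snd (step₂ n)
  where
  step₁ : Neutral t → ∀ {t′} → fst t ⟶ t′ → Red A t′
  step₁ _  (fstᶜ s) = proj₁ (h s)
  step₁ () β-fst

  step₂ : Neutral t → ∀ {t′} → snd t ⟶ t′ → Red B t′
  step₂ _  (sndᶜ s) = proj₂ (h s)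
  step₂ () β-snd
red-neutral {t = t} (A ⊕ B) n h = acc (λ s → proj₁ (h s)) , left n , right n
  where
  left : Neutral t → ∀ u → t ⟶* inl u → Red A u
  left () u ε
  left _  u (s ◅ ss) = proj₁ (proj₂ (h s)) u ss

  right : Neutral t → ∀ u → t ⟶* inr u → Red B u
  right () u ε
  right _  u (s ◅ ss) = proj₂ (proj₂ (h s)) u ss
red-neutral {t = t} (A ⇒ B) n h u r = go u (red-sn A r) r
  where
  mutual
    go : ∀ u → SN u → Red A u → Red B (app t u)
    go u a r = red-neutral B app (step n a r)

    step : Neutral t → ∀ {u v} → SN u → Red A u → app t u ⟶ v → Red B v
    step _  a        r (appˡ s) = h s _ r
    step _  (acc rs) r (appʳ s) = go _ (rs s) (red-step A r s)
    step () _        _ β-lam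
    step () _        _ β-D-inl
    step () _        _ β-D-inr
red-neutral {t = t} (□ A) n h = red-neutral A inst (step n)
  where
  step : Neutral t → ∀ {t′} → inst t ⟶ t′ → Red A t′
  step _  (instᶜ s) = h s
  step () β-gen
red-neutral {t = t} (◇ A) n h = acc (λ s → proj₁ (h s)) , content n
  where
  content : Neutral t → ∀ u → t ⟶* pack u → Red A u
  content () u ε
  content _  u (s ◅ ss) = proj₂ (h s) u ss

-- Reducibility of the constructions

infix 3 _⊨_∶_

-- All instances of w by terms reducible at A are reducible at C.
_⊨_∶_ : Ty → Tm (suc k) → Ty → Set
A ⊨ w ∶ C = ∀ v → Red A v → Red C (w [ v ])

⊨-step : ∀ A C → A ⊨ w ∶ C → w ⟶ w₁ → A ⊨ w₁ ∶ C
⊨-step A C h s v r = red-step C (h v r) (step-sub (v ▹ var) s)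

⊨-sn : ∀ A C → A ⊨ w ∶ C → SN w
⊨-sn A C h =
  sn-reflect (_[ stuck ]) (step-sub (stuck ▹ var)) (red-sn C (h stuck (red-stuck A)))

red-pair : ∀ A B → Red A u → Red B t → Red (A ⊗ B) (pair u t)
red-pair A B p q =
  first (red-sn A p) (red-sn B q) p , second (red-sn A p) (red-sn B q) q
  where
  first : SN u → SN t → Red A u → Red A (fst (pair u t))
  first a@(acc rs) b@(acc qs) p = red-neutral A fst λ
    { β-fst             → p
    ; (fstᶜ (pairˡ s)) → first (rs s) b (red-step A p s)
    ; (fstᶜ (pairʳ s)) → first a (qs s) p }

  second : SN u → SN t → Red B t → Red B (snd (pair u t))
  second a@(acc rs) b@(acc qs) q = red-neutral B snd λ
    { β-snd             → q
    ; (sndᶜ (pairˡ s)) → second (rs s) b q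
    ; (sndᶜ (pairʳ s)) → second a (qs s) (red-step B q s) }

red-lam : ∀ A B → A ⊨ w ∶ B → Red (A ⇒ B) (lam w)
red-lam A B h _ r = go (⊨-sn A B h) (red-sn A r) h r
  where
  go : SN w → SN u → A ⊨ w ∶ B → Red A u → Red B (app (lam w) u)
  go a@(acc rs) b@(acc qs) h r = red-neutral B app λ
    { β-lam           → h _ r
    ; (appˡ (lamᶜ s)) → go (rs s) b (⊨-step A B h s) r
    ; (appʳ s)        → go a (qs s) h (red-step A r s) }

red-inl : ∀ A B → Red A u → Red (A ⊕ B) (inl u)
red-inl A B p = sn (red-sn A p) , (λ _ → left p) , (λ _ → right)
  where
  sn : SN u → SN (inl u)
  sn (acc rs) = acc λ { (inlᶜ s) → sn (rs s) }

  left : Red A u → inl u ⟶* inl v → Red A v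
  left p ε             = p
  left p (inlᶜ s ◅ ss) = left (red-step A p s) ss

  right : inl u ⟶* inr v → Red B v
  right (inlᶜ s ◅ ss) = right ss

red-inr : ∀ A B → Red B u → Red (A ⊕ B) (inr u)
red-inr A B q = sn (red-sn B q) , (λ _ → left) , (λ _ → right q)
  where
  sn : SN u → SN (inr u)
  sn (acc rs) = acc λ { (inrᶜ s) → sn (rs s) }

  left : inr u ⟶* inl v → Red A v
  left (inrᶜ s ◅ ss) = left ss

  right : Red B u → inr u ⟶* inr v → Red B v
  right q ε             = q
  right q (inrᶜ s ◅ ss) = right (red-step B q s) ss

red-case : ∀ A B C → Red (A ⊕ B) u → A ⊨ w₁ ∶ C → B ⊨ w₂ ∶ C →
           Red C (case u w₁ w₂)
red-case A B C p h₁ h₂ = go (proj₁ p) (⊨-sn A C h₁) (⊨-sn B C h₂) p h₁ h₂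
  where
  go : SN u → SN w₁ → SN w₂ → Red (A ⊕ B) u → A ⊨ w₁ ∶ C → B ⊨ w₂ ∶ C →
       Red C (case u w₁ w₂)
  go a@(acc rs) b₁@(acc qs₁) b₂@(acc qs₂) p h₁ h₂ = red-neutral C case λ
    { β-inl     → h₁ _ (proj₁ (proj₂ p) _ ε)
    ; β-inr     → h₂ _ (proj₂ (proj₂ p) _ ε)
    ; (caseᶜ s) → go (rs s) b₁ b₂ (red-step (A ⊕ B) p s) h₁ h₂
    ; (caseˡ s) → go a (qs₁ s) b₂ p (⊨-step A C h₁ s) h₂
    ; (caseʳ s) → go a b₁ (qs₂ s) p h₁ (⊨-step B C h₂ s) }

red-gen : ∀ A → Red A u → Red (□ A) (gen u)
red-gen A p = go (red-sn A p) p
  where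
  go : SN u → Red A u → Red A (inst (gen u))
  go (acc rs) p = red-neutral A inst λ
    { β-gen            → p
    ; (instᶜ (genᶜ s)) → go (rs s) (red-step A p s) }

red-pack : ∀ A → Red A u → Red (◇ A) (pack u)
red-pack A p = sn (red-sn A p) , λ _ → content p
  where
  sn : SN u → SN (pack u)
  sn (acc rs) = acc λ { (packᶜ s) → sn (rs s) }

  content : Red A u → pack u ⟶* pack v → Red A v
  content p ε              = p
  content p (packᶜ s ◅ ss) = content (red-step A p s) ss

red-unpack : ∀ A C → Red (◇ A) u → A ⊨ w ∶ C → Red C (unpack u w)
red-unpack A C p h = go (proj₁ p) (⊨-sn A C h) p h
  where
  go : SN u → SN w → Red (◇ A) u → A ⊨ w ∶ C → Red C (unpack u w)
  go a@(acc rs) b@(acc qs) p h = red-neutral C unpack λ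
    { β-pack      → h _ (proj₂ p _ ε)
    ; (unpackˡ s) → go (rs s) b (red-step (◇ A) p s) h
    ; (unpackʳ s) → go a (qs s) p (⊨-step A C h s) }

-- When app D t is contracted at the root, t is gen (inl u) or gen (inr u), and
-- the reducibility of t provides that of its one-step instance inl u or inr u.
red-D : ∀ A B → Red (□ (A ⊕ B) ⇒ □ A ⊕ B) (D {k})
red-D A B _ p = go (red-sn (□ (A ⊕ B)) p) p
  where
  go : SN t → Red (□ (A ⊕ B)) t → Red (□ A ⊕ B) (app D t)
  go (acc rs) p = red-neutral (□ A ⊕ B) app λ
    { β-D-inl  → red-inl (□ A) B
                   (red-gen A (proj₁ (proj₂ (red-step (A ⊕ B) p β-gen)) _ ε))
    ; β-D-inr  → red-inr (□ A) B (proj₂ (proj₂ (red-step (A ⊕ B) p β-gen)) _ ε)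
    ; (appʳ s) → go (rs s) (red-step (□ (A ⊕ B)) p s) }

red-efq : SN u → Red base (efq u)
red-efq (acc rs) = acc λ { (efqᶜ s) → red-efq (rs s) }

-- Erasure of proofs

module Erasure (𝓛 : Language) where
  open module C = CD 𝓛 hiding (_⇒_)

  private
    variable
      m n : ℕ

  -- The simple type of a formula, forgetting all atoms and terms.
  shape : Formula n → Ty
  shape (atom P)  = base
  shape (A ∧ B)   = shape A ⊗ shape B
  shape (A ∨ B)   = shape A ⊕ shape B
  shape (A C.⇒ B) = shape A ⇒ shape B
  shape (all A)   = □ (shape A)
  shape (ex A)    = ◇ (shape A)

  shape-subst : (σ : Subst m n) (A : Formula m) → shape (substFormula σ A) ≡ shape A
  shape-subst σ (atom P)  = refl
  shape-subst σ (A ∧ B)   = cong₂ _⊗_ (shape-subst σ A) (shape-subst σ B)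
  shape-subst σ (A ∨ B)   = cong₂ _⊕_ (shape-subst σ A) (shape-subst σ B)
  shape-subst σ (A C.⇒ B) = cong₂ _⇒_ (shape-subst σ A) (shape-subst σ B)
  shape-subst σ (all A)   = cong □ (shape-subst (lift σ) A)
  shape-subst σ (ex A)    = cong ◇ (shape-subst (lift σ) A)

  -- Deletes first-order terms and annotations.
  erase : Proof n k → Tm k
  erase (var x)            = var x
  erase ⟨ u , t ⟩          = pair (erase u) (erase t)
  erase (u π₀)             = fst (erase u)
  erase (u π₁)             = snd (erase u)
  erase (t · u)            = app (erase t) (erase u)
  erase (ƛ A u)            = lam (erase u)
  erase (ι₀ u)             = inl (erase u)
  erase (ι₁ u)             = inr (erase u)
  erase (case u A w₁ B w₂) = case (erase u) (erase w₁) (erase w₂)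
  erase (u ∙ a)            = inst (erase u)
  erase (Λ u)              = gen (erase u)
  erase (pack a u)         = pack (erase u)
  erase (unpack u A t)     = unpack (erase u) (erase t)
  erase (𝓓 A B)            = D
  erase (efq P u)          = efq (erase u)

  erase-substᵗ : (σ : Subst m n) (t : Proof m k) → erase (substᵗ σ t) ≡ erase t
  erase-substᵗ σ (var x)            = refl
  erase-substᵗ σ ⟨ u , t ⟩          = cong₂ pair (erase-substᵗ σ u) (erase-substᵗ σ t)
  erase-substᵗ σ (u π₀)             = cong fst (erase-substᵗ σ u)
  erase-substᵗ σ (u π₁)             = cong snd (erase-substᵗ σ u)
  erase-substᵗ σ (t · u)            = cong₂ app (erase-substᵗ σ t) (erase-substᵗ σ u)
  erase-substᵗ σ (ƛ A u)            = cong lam (erase-substᵗ σ u)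
  erase-substᵗ σ (ι₀ u)             = cong inl (erase-substᵗ σ u)
  erase-substᵗ σ (ι₁ u)             = cong inr (erase-substᵗ σ u)
  erase-substᵗ σ (case u A w₁ B w₂) =
    cong₃ case (erase-substᵗ σ u) (erase-substᵗ σ w₁) (erase-substᵗ σ w₂)
  erase-substᵗ σ (u ∙ a)            = cong inst (erase-substᵗ σ u)
  erase-substᵗ σ (Λ u)              = cong gen (erase-substᵗ (lift σ) u)
  erase-substᵗ σ (pack a u)         = cong pack (erase-substᵗ σ u)
  erase-substᵗ σ (unpack u A t)     =
    cong₂ unpack (erase-substᵗ σ u) (erase-substᵗ (lift σ) t)
  erase-substᵗ σ (𝓓 A B)            = refl
  erase-substᵗ σ (efq P u)          = cong efq (erase-substᵗ σ u)

  erase-rename : {ρ ρ′ : Fin k → Fin l} → (∀ x → ρ x ≡ ρ′ x) →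
                 (t : Proof n k) → erase (rename ρ t) ≡ ren ρ′ (erase t)
  erase-rename {k} {l} {ρ = ρ} {ρ′} eq = go
    where
    eq⁺ : ∀ x → liftRen ρ x ≡ extᵣ ρ′ x
    eq⁺ zero    = refl
    eq⁺ (suc x) = cong suc (eq x)

    go : (t : Proof m k) → erase (rename ρ t) ≡ ren ρ′ (erase t)
    go (var x)            = cong var (eq x)
    go ⟨ u , t ⟩          = cong₂ pair (go u) (go t)
    go (u π₀)             = cong fst (go u)
    go (u π₁)             = cong snd (go u)
    go (t · u)            = cong₂ app (go t) (go u)
    go (ƛ A u)            = cong lam (erase-rename eq⁺ u)
    go (ι₀ u)             = cong inl (go u)
    go (ι₁ u)             = cong inr (go u)
    go (case u A w₁ B w₂) =
      cong₃ case (go u) (erase-rename eq⁺ w₁) (erase-rename eq⁺ w₂)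
    go (u ∙ a)            = cong inst (go u)
    go (Λ u)              = cong gen (go u)
    go (pack a u)         = cong pack (go u)
    go (unpack u A t)     = cong₂ unpack (go u) (erase-rename eq⁺ t)
    go (𝓓 A B)            = refl
    go (efq P u)          = cong efq (go u)

  erase-substᵖ : {τ : Substᵖ n k l} {σ : Fin k → Tm l} →
                 (∀ x → erase (τ x) ≡ σ x) →
                 (t : Proof n k) → erase (substᵖ τ t) ≡ sub σ (erase t)
  erase-substᵖ {n} {k} {l} {τ} {σ} eq = go
    where
    liftᵖ-eq : {τ : Substᵖ m k l} → (∀ x → erase (τ x) ≡ σ x) →
               ∀ x → erase (liftᵖ τ x) ≡ ext σ x
    liftᵖ-eq eq zero    = refl
    liftᵖ-eq eq (suc x) = trans (erase-rename (λ _ → refl) _) (cong (ren suc) (eq x))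

    shiftᵖ-eq : ∀ x → erase (shiftᵖ τ x) ≡ σ x
    shiftᵖ-eq x = trans (erase-substᵗ shift (τ x)) (eq x)

    go : (t : Proof n k) → erase (substᵖ τ t) ≡ sub σ (erase t)
    go (var x)            = eq x
    go ⟨ u , t ⟩          = cong₂ pair (go u) (go t)
    go (u π₀)             = cong fst (go u)
    go (u π₁)             = cong snd (go u)
    go (t · u)            = cong₂ app (go t) (go u)
    go (ƛ A u)            = cong lam (erase-substᵖ (liftᵖ-eq eq) u)
    go (ι₀ u)             = cong inl (go u)
    go (ι₁ u)             = cong inr (go u)
    go (case u A w₁ B w₂) =
      cong₃ case (go u) (erase-substᵖ (liftᵖ-eq eq) w₁) (erase-substᵖ (liftᵖ-eq eq) w₂)
    go (u ∙ a)            = cong inst (go u)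
    go (Λ u)              = cong gen (erase-substᵖ shiftᵖ-eq u)
    go (pack a u)         = cong pack (go u)
    go (unpack u A t)     =
      cong₂ unpack (go u) (erase-substᵖ (liftᵖ-eq shiftᵖ-eq) t)
    go (𝓓 A B)            = refl
    go (efq P u)          = cong efq (go u)

  erase-[]ᵖ : (w : Proof n (suc k)) (u : Proof n k) →
              erase (w [ u ]ᵖ) ≡ erase w [ erase u ]
  erase-[]ᵖ w u = erase-substᵖ (λ { zero → refl ; (suc x) → refl }) w

  erase-▷ : {t t′ : Proof n k} → t ▷ t′ → erase t ⟶ erase t′
  erase-▷ (β-⇒ {u = u} {t = t}) = ⟶-resp-≡ (sym (erase-[]ᵖ u t)) β-lam
  erase-▷ (β-∀ {u = u} {a = a}) = ⟶-resp-≡ (sym (erase-substᵗ (single a) u)) β-gen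
  erase-▷ β-∧₀ = β-fst
  erase-▷ β-∧₁ = β-snd
  erase-▷ (β-∨₀ {u = u} {w₁ = w₁}) = ⟶-resp-≡ (sym (erase-[]ᵖ w₁ u)) β-inl
  erase-▷ (β-∨₁ {u = u} {w₂ = w₂}) = ⟶-resp-≡ (sym (erase-[]ᵖ w₂ u)) β-inr
  erase-▷ (β-∃ {a = a} {u = u} {v = v}) =
    ⟶-resp-≡ (sym (trans (erase-[]ᵖ (v [ a ]ᵗ) u)
                         (cong (_[ erase u ]) (erase-substᵗ (single a) v))))
             β-pack
  erase-▷ β-𝓓₀ = β-D-inl
  erase-▷ (β-𝓓₁ {u = u}) =
    ⟶-resp-≡ (cong inr (sym (erase-substᵗ (single _) u))) β-D-inr

  -- No step is lost, so strong normalization of the erasure suffices.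
  erase-step : {t t′ : Proof n k} → t ↦ t′ → erase t ⟶ erase t′
  erase-step (root r)      = erase-▷ r
  erase-step (⟨⟩ˡ s)       = pairˡ (erase-step s)
  erase-step (⟨⟩ʳ s)       = pairʳ (erase-step s)
  erase-step (π₀ᶜ s)       = fstᶜ (erase-step s)
  erase-step (π₁ᶜ s)       = sndᶜ (erase-step s)
  erase-step (·ˡ s)        = appˡ (erase-step s)
  erase-step (·ʳ s)        = appʳ (erase-step s)
  erase-step (ƛᶜ s)        = lamᶜ (erase-step s)
  erase-step (ι₀ᶜ s)       = inlᶜ (erase-step s)
  erase-step (ι₁ᶜ s)       = inrᶜ (erase-step s)
  erase-step (caseᶜ s)     = caseᶜ (erase-step s)
  erase-step (caseˡ s)     = caseˡ (erase-step s)
  erase-step (caseʳ s)     = caseʳ (erase-step s)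
  erase-step (∙ᶜ s)        = instᶜ (erase-step s)
  erase-step (Λᶜ s)        = genᶜ (erase-step s)
  erase-step (packᶜ s)     = packᶜ (erase-step s)
  erase-step (unpackˡ s)   = unpackˡ (erase-step s)
  erase-step (unpackʳ s)   = unpackʳ (erase-step s)
  erase-step (efqᶜ s)      = efqᶜ (erase-step s)

  -- The fundamental theorem

  -- Substitutions of reducible terms for the variables of a context.
  RedEnv : Context n k → (Fin k → Tm l) → Set
  RedEnv Γ ρ = ∀ x → Red (shape (lookup Γ x)) (ρ x)

  redEnv-wk : {Γ : Context n k} {ρ : Fin k → Tm l} →
              RedEnv Γ ρ → RedEnv (map wkᶠ Γ) ρ
  redEnv-wk {Γ = Γ} {ρ} h x =
    subst (λ A → Red A (ρ x))
          (sym (trans (cong shape (lookup-map x wkᶠ Γ)) (shape-subst shift (lookup Γ x))))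
          (h x)

  redEnv-▹ : {Γ : Context n k} {A : Formula n} {ρ : Fin k → Tm l} {v : Tm l} →
             Red (shape A) v → RedEnv Γ ρ → RedEnv (A ∷ Γ) (v ▹ ρ)
  redEnv-▹ r h zero    = r
  redEnv-▹ r h (suc x) = h x

  mutual
    -- The erasure of a derivable proof is reducible under every reducible
    -- substitution.  The eigenvariable conditions enter only through redEnv-wk
    -- and the invariance of shape under weakening.
    fundamental : {Γ : Context n k} {t : Proof n k} {A : Formula n} → Γ ⊢ t ∶ A →
                  {ρ : Fin k → Tm l} → RedEnv Γ ρ → Red (shape A) (sub ρ (erase t))
    fundamental (ax x) h = h x
    fundamental (∧I {A = A} {B = B} d e) h =
      red-pair (shape A) (shape B) (fundamental d h) (fundamental e h)
    fundamental (∧E₀ d) h = proj₁ (fundamental d h)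
    fundamental (∧E₁ d) h = proj₂ (fundamental d h)
    fundamental (⇒E d e) h = fundamental d h _ (fundamental e h)
    fundamental (⇒I {A = A} {B = B} d) h =
      red-lam (shape A) (shape B) (fundamental-bound d h)
    fundamental (∨I₀ {A = A} {B = B} d) h =
      red-inl (shape A) (shape B) (fundamental d h)
    fundamental (∨I₁ {B = B} {A = A} d) h =
      red-inr (shape A) (shape B) (fundamental d h)
    fundamental (∨E {A = A} {B = B} {C = C} d e₁ e₂) h =
      red-case (shape A) (shape B) (shape C)
        (fundamental d h) (fundamental-bound e₁ h) (fundamental-bound e₂ h)
    fundamental {t = u ∙ a} (∀E {A = A} d a) {ρ} h =
      subst (λ B → Red B (sub ρ (erase (u ∙ a)))) (sym (shape-subst (single a) A))
            (fundamental d h)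
    fundamental {Γ = Γ} (∀I {A = A} d) h =
      red-gen (shape A) (fundamental d (redEnv-wk {Γ = Γ} h))
    fundamental {t = pack a u} (∃I {A = A} d) {ρ} h =
      red-pack (shape A)
        (subst (λ B → Red B (sub ρ (erase u))) (shape-subst (single a) A)
               (fundamental d h))
    fundamental {Γ = Γ} (∃E {A = A} {t = t} {C = C} d e) {ρ} h =
      red-unpack (shape A) (shape C) (fundamental d h)
        (subst (shape A ⊨ sub (ext ρ) (erase t) ∶_) (shape-subst shift C)
               (fundamental-bound e (redEnv-wk {Γ = Γ} h)))
    fundamental (cd A B) h =
      subst (λ B′ → Red (□ (shape A ⊕ B′) ⇒ □ (shape A) ⊕ shape B) D)
            (sym (shape-subst shift B)) (red-D (shape A) (shape B))
    fundamental (⊥E d) h = red-efq (fundamental d h)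

    -- The fundamental theorem for the premise of a rule binding a variable of type A.
    fundamental-bound : {Γ : Context n k} {t : Proof n (suc k)} {A C : Formula n} →
                        A ∷ Γ ⊢ t ∶ C → {ρ : Fin k → Tm l} → RedEnv Γ ρ →
                        shape A ⊨ sub (ext ρ) (erase t) ∶ shape C
    fundamental-bound {Γ = Γ} {t = t} {A} {C} d {ρ} h v r =
      subst (Red (shape C)) (sym (sub-ext-[] ρ (erase t) v))
            (fundamental d (redEnv-▹ {Γ = Γ} {A = A} r h))

  -- All the variables are instantiated by stuck, which is reducible whatever
  -- the types in the context are; step-sub then reflects strong normalization.
  erase-sn : {Γ : Context n k} {t : Proof n k} {A : Formula n} →
             Γ ⊢ t ∶ A → SN (erase t)
  erase-sn {k = k} {Γ = Γ} {A = A} d =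
    sn-reflect (sub instantiate) (step-sub instantiate)
               (red-sn (shape A) (fundamental d (λ x → red-stuck (shape (lookup Γ x)))))
    where
    instantiate : Fin k → Tm 0
    instantiate _ = stuck

  no-infinite-reduction : {t : Proof n k} → SN (erase t) → StronglyNormalizable t
  no-infinite-reduction {n} {k} a (s , refl , steps) = go zero a
    where
    go : ∀ i → SN (erase (s i)) → ⊥
    go i (acc rs) = go (suc i) (rs (erase-step (steps i)))

theorem3 : (𝓛 : Language) → let open CD 𝓛 in
    ∀ {n k : ℕ} {Γ : Context n k} (t : Proof n k) (A : Formula n) →
    Γ ⊢ t ∶ A → StronglyNormalizable t
theorem3 𝓛 t A d = no-infinite-reduction (erase-sn d)
  where open Erasure 𝓛
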